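{- Let $T$ be a $\mathcal P^{\mathbf A}$-theory and $\Phi(\overrightarrow x)$ a set of $\mathcal P^{\mathbf A}$-formulas. The following are equivalent: (i) for any models $\langle\mathbf A,\mathbf M\rangle\subseteq\langle\mathbf A,\mathbf N\rangle$ of $T$ and any tuple $\overrightarrow d$ of elements of $M$, if $\langle\mathbf A,\mathbf N\rangle\models\Phi[\overrightarrow d]$ then $\langle\mathbf A,\mathbf M\rangle\models\Phi[\overrightarrow d]$; (ii) there is a set $\Theta(\overrightarrow x)$ of universal $\mathcal P^{\mathbf A}$-formulas such that $T,\Phi\models\Theta$ and $T,\Theta\models\Phi$.
   Context: Fix a finite MTL-chain $\mathbf{A}$ (a finite linearly ordered MTL-algebra, possibly expanded with further operations), with top $1$ and bottom $0$. For a predicate language $\mathcal P$ containing a crisp equality symbol $\approx$, an $\mathbf{A}$-structure $\langle \mathbf A,\mathbf M\rangle$ consists of a nonempty domain $M$, functions $F_{\mathbf M}:M^n\to M$ for $n$-ary function symbols, and maps $P_{\mathbf M}:M^n\to A$ for $n$-ary predicate symbols; $\approx$ takes value $1$ on equal and $0$ on distinct elements. Truth values are computed Tarski-style: connectives by the operations of $\mathbf A$, $\forall$ by infimum, $\exists$ by supremum over the domain. $\langle\mathbf A,\mathbf M\rangle\models\Phi[\overrightarrow d]$ means every formula of $\Phi$ takes value $1$ at $\overrightarrow d$; a model of a theory (set of sentences) is a structure in which all its sentences take value $1$. $\mathcal P^{\mathbf A}$ is $\mathcal P$ expanded by a truth constant $\overline a$ for each $a\in A$, always interpreted as $a$; all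 structures are over the fixed $\mathbf A$. $\langle\mathbf A,\mathbf M\rangle\subseteq\langle\mathbf A,\mathbf N\rangle$ (substructure) means $M\subseteq N$ and function and predicate symbols are interpreted in $\mathbf M$ by restriction from $\mathbf N$. A universal formula has the form $(\forall\overrightarrow x)\psi$ with $\psi$ quantifier-free. $T,\Phi\models\Theta$ means: for every model $\langle\mathbf A,\mathbf M\rangle$ of $T$ and tuple $\overrightarrow d$ in $M$, if $\langle\mathbf A,\mathbf M\rangle\models\Phi[\overrightarrow d]$ then $\langle\mathbf A,\mathbf M\rangle\models\Theta[\overrightarrow d]$. -}

module Defs where

open import Axiom.ExcludedMiddle using (ExcludedMiddle)
open import Algebra.Core using (Op₂)
open import Algebra.Structures using (IsCommutativeMonoid)
open import Data.Fin.Base using (Fin)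
open import Data.List.Base using (List; []; _∷_; tabulate)
open import Data.List.Membership.Propositional using (_∈_)
open import Data.List.Membership.Propositional.Properties using (∈-tabulate⁺)
open import Data.List.Relation.Unary.Any using (here; there)
open import Data.Nat.Base using (ℕ; suc)
open import Data.Product.Base using (Σ; ∃; _×_; _,_; proj₁; proj₂)
open import Data.Sum.Base using (_⊎_)
open import Data.Vec.Base using (Vec; []; _∷_; lookup; map)
open import Data.Vec.Relation.Unary.All using (All)
open import Function.Bundles using (_↔_; Inverse)
open import Level using (_⊔_) renaming (suc to lsuc)
open import Relation.Binary.Bundles using (Poset)
open import Relation.Binary.Core using (Rel)
open import Relation.Binary.Definitions using (Total)
open import Relation.Binary.Lattice.Definitions using (Exponential)
open import Relation.Binary.Lattice.Structures using (IsBoundedLattice)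
open import Relation.Binary.PropositionalEquality
  using (_≡_; subst)
open import Relation.Nullary.Decidable.Core using (Dec; yes; no)
open import Relation.Nullary.Irrelevant using (Irrelevant)
open import Relation.Nullary.Negation.Core using (contradiction)
open import Relation.Unary using (Pred) renaming (_∈_ to _∈ᵖ_)

-- The ambient metatheory is classical (ZFC).  The law of excluded middle and
-- this form of the axiom of choice enter the results as explicit hypotheses.
Zorn : ∀ c ℓ₁ ℓ₂ p → Set (lsuc (c ⊔ ℓ₁ ⊔ ℓ₂ ⊔ p))
Zorn c ℓ₁ ℓ₂ p =
  (P : Poset c ℓ₁ ℓ₂) → let open Poset P in
  ((C : Pred Carrier p) →
     (∀ {x y} → x ∈ᵖ C → y ∈ᵖ C → x ≤ y ⊎ y ≤ x) →
     ∃ λ u → ∀ {x} → x ∈ᵖ C → x ≤ u) →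
  ∃ λ m → ∀ {x} → m ≤ x → x ≤ m

-- An MTL-algebra is a bounded, commutative, integral, prelinear residuated
-- lattice; integrality is the use of 1# as the unit of _&_.
record MTLAlgebra ℓ : Set (lsuc ℓ) where
  infix  4 _≤_
  infixr 5 _⇒_
  infixr 6 _∨_
  infixr 7 _∧_ _&_
  field
    Carrier             : Set ℓ
    _≤_                 : Rel Carrier ℓ
    _∧_ _∨_ _&_ _⇒_     : Op₂ Carrier
    0# 1#               : Carrier
    isBoundedLattice    : IsBoundedLattice _≡_ _≤_ _∨_ _∧_ 1# 0#
    isCommutativeMonoid : IsCommutativeMonoid _≡_ _&_ 1#
    residuated          : Exponential _≤_ _&_ _⇒_
    prelinear           : ∀ x y → (x ⇒ y) ∨ (y ⇒ x) ≡ 1#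

record FiniteMTLChain ℓ : Set (lsuc ℓ) where
  field
    mtlAlgebra : MTLAlgebra ℓ
  open MTLAlgebra mtlAlgebra public
  field
    total  : Total _≤_
    finite : ∃ λ n → Fin n ↔ Carrier
    -- The further operations expanding the MTL-signature, indexed by arity.
    Op     : ℕ → Set ℓ
    interp : ∀ {k} → Op k → Vec Carrier k → Carrier

-- The crisp equality symbol and the truth constants belong to every language
-- and are part of the syntax of formulas below.
record Language ℓ : Set (lsuc ℓ) where
  field
    Func : ℕ → Set ℓ
    Pr   : ℕ → Set ℓ

module Syntax {ℓ} (𝐀 : FiniteMTLChain ℓ) (𝒫 : Language ℓ) where
  open FiniteMTLChain 𝐀 using (Op) renaming (Carrier to A)
  open Language 𝒫

  infix  9 _≈̇_
  infixr 7 _∧̇_ _&̇_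
  infixr 6 _∨̇_
  infixr 5 _⇒̇_

  data Term (n : ℕ) : Set ℓ where
    var : Fin n → Term n
    fun : ∀ {k} → Func k → Vec (Term n) k → Term n

  -- 𝒫ᴬ-formulas with free variables among x₀,…,xₙ₋₁ (de Bruijn indices).  The
  -- constants 0̄ and 1̄ of the MTL-signature are `const 0#` and `const 1#`.
  data Formula (n : ℕ) : Set ℓ where
    pr                      : ∀ {k} → Pr k → Vec (Term n) k → Formula n
    _≈̇_                     : Term n → Term n → Formula n
    const                   : A → Formula n
    _∧̇_ _∨̇_ _&̇_ _⇒̇_         : Formula n → Formula n → Formula n
    op                      : ∀ {k} → Op k → Vec (Formula n) k → Formula n
    ∀̇_ ∃̇_                   : Formula (suc n) → Formula n

  Theory : Set (lsuc ℓ)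
  Theory = Pred (Formula 0) ℓ

  data QuantifierFree {n} : Pred (Formula n) ℓ where
    pr    : ∀ {k} (P : Pr k) ts → QuantifierFree (pr P ts)
    _≈̇_   : ∀ s t → QuantifierFree (s ≈̇ t)
    const : ∀ a → QuantifierFree (const a)
    _∧̇_   : ∀ {φ ψ} → QuantifierFree φ → QuantifierFree ψ → QuantifierFree (φ ∧̇ ψ)
    _∨̇_   : ∀ {φ ψ} → QuantifierFree φ → QuantifierFree ψ → QuantifierFree (φ ∨̇ ψ)
    _&̇_   : ∀ {φ ψ} → QuantifierFree φ → QuantifierFree ψ → QuantifierFree (φ &̇ ψ)
    _⇒̇_   : ∀ {φ ψ} → QuantifierFree φ → QuantifierFree ψ → QuantifierFree (φ ⇒̇ ψ)
    op    : ∀ {k} (o : Op k) {φs} → All QuantifierFree φs → QuantifierFree (op o φs)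

  data Universal {n} : Pred (Formula n) ℓ where
    matrix : ∀ {ψ} → QuantifierFree ψ → Universal ψ
    ∀̇_     : ∀ {φ} → Universal φ → Universal (∀̇ φ)

-- Suprema and infima of arbitrary families in a finite chain; excluded middle
-- decides which truth values a family attains.
module Bounds {ℓ} (em : ExcludedMiddle ℓ) (𝐀 : FiniteMTLChain ℓ) where
  open FiniteMTLChain 𝐀 renaming (Carrier to A)
  open IsBoundedLattice isBoundedLattice
    using (reflexive; minimum; x≤x∨y; y≤x∨y; ∨-least)
    renaming (trans to ≤-trans)

  IsSup IsInf : {D : Set ℓ} → (D → A) → A → Set ℓ
  IsSup f s = (∀ d → f d ≤ s) × (∀ u → (∀ d → f d ≤ u) → s ≤ u)
  IsInf f i = (∀ d → i ≤ f d) × (∀ l → (∀ d → l ≤ f d) → l ≤ i)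

  private
    enum : List A
    enum = tabulate (Inverse.to (proj₂ finite))

    ∈-enum : ∀ a → a ∈ enum
    ∈-enum a = subst (_∈ enum) (Inverse.strictlyInverseˡ F a)
                     (∈-tabulate⁺ (Inverse.from F a))
      where F = proj₂ finite

    supOn : {D : Set ℓ} (f : D → A) (as : List A) →
            ∃ λ s → (∀ d → f d ∈ as → f d ≤ s) ×
                    (∀ u → (∀ d → f d ≤ u) → s ≤ u)
    supOn f []       = 0# , (λ _ ()) , λ u _ → minimum u
    supOn f (a ∷ as) with supOn f as | em {∃ λ d → f d ≡ a}
    ... | s , ub , least | yes (d₀ , fd₀≡a) = a ∨ s ,
          (λ { d (here fd≡a) → ≤-trans (reflexive fd≡a) (x≤x∨y a s)
             ; d (there fd∈) → ≤-trans (ub d fd∈) (y≤x∨y a s) }) ,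
          λ u f≤u → ∨-least (subst (_≤ u) fd₀≡a (f≤u d₀)) (least u f≤u)
    ... | s , ub , least | no ∄d = s ,
          (λ { d (here fd≡a) → contradiction (d , fd≡a) ∄d
             ; d (there fd∈) → ub d fd∈ }) ,
          least

  supremum : {D : Set ℓ} (f : D → A) → ∃ (IsSup f)
  supremum f with supOn f enum
  ... | s , ub , least = s , (λ d → ub d (∈-enum (f d))) , least

  infimum : {D : Set ℓ} (f : D → A) → ∃ (IsInf f)
  infimum f with supremum {D = Σ A λ l → ∀ d → l ≤ f d} proj₁
  ... | i , ub , least =
        i , (λ d → least (f d) λ (_ , l≤f) → l≤f d) , λ l l≤f → ub (l , l≤f)

  ⋁ ⋀ : {D : Set ℓ} → (D → A) → A
  ⋁ f = proj₁ (supremum f)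
  ⋀ f = proj₁ (infimum f)

module Semantics {ℓ} (em : ExcludedMiddle ℓ)
                 (𝐀 : FiniteMTLChain ℓ) (𝒫 : Language ℓ) where
  open FiniteMTLChain 𝐀 renaming (Carrier to A)
  open Language 𝒫
  open Syntax 𝐀 𝒫 public
  open Bounds em 𝐀 public

  record Structure : Set (lsuc ℓ) where
    field
      Dom      : Set ℓ
      nonempty : Dom
      func     : ∀ {k} → Func k → Vec Dom k → Dom
      pred     : ∀ {k} → Pr k → Vec Dom k → A

  open Structure public using (Dom)

  crisp : {P : Set ℓ} → Dec P → A
  crisp (yes _) = 1#
  crisp (no  _) = 0#

  module _ (M : Structure) where
    open Structure M using (func; pred)

    mutual
      ⟦_⟧ᵗ : ∀ {n} → Term n → Vec (Dom M) n → Dom M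
      ⟦ var i ⟧ᵗ    v = lookup v i
      ⟦ fun F ts ⟧ᵗ v = func F (⟦ ts ⟧ᵗˢ v)

      ⟦_⟧ᵗˢ : ∀ {n k} → Vec (Term n) k → Vec (Dom M) n → Vec (Dom M) k
      ⟦ [] ⟧ᵗˢ     v = []
      ⟦ t ∷ ts ⟧ᵗˢ v = ⟦ t ⟧ᵗ v ∷ ⟦ ts ⟧ᵗˢ v

    mutual
      ⟦_⟧ : ∀ {n} → Formula n → Vec (Dom M) n → A
      ⟦ pr P ts ⟧ v = pred P (⟦ ts ⟧ᵗˢ v)
      ⟦ s ≈̇ t ⟧   v = crisp (em {⟦ s ⟧ᵗ v ≡ ⟦ t ⟧ᵗ v})
      ⟦ const a ⟧ v = a
      ⟦ φ ∧̇ ψ ⟧   v = ⟦ φ ⟧ v ∧ ⟦ ψ ⟧ v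
      ⟦ φ ∨̇ ψ ⟧   v = ⟦ φ ⟧ v ∨ ⟦ ψ ⟧ v
      ⟦ φ &̇ ψ ⟧   v = ⟦ φ ⟧ v & ⟦ ψ ⟧ v
      ⟦ φ ⇒̇ ψ ⟧   v = ⟦ φ ⟧ v ⇒ ⟦ ψ ⟧ v
      ⟦ op o φs ⟧ v = interp o (⟦ φs ⟧ˢ v)
      ⟦ ∀̇ φ ⟧     v = ⋀ λ d → ⟦ φ ⟧ (d ∷ v)
      ⟦ ∃̇ φ ⟧     v = ⋁ λ d → ⟦ φ ⟧ (d ∷ v)

      ⟦_⟧ˢ : ∀ {n k} → Vec (Formula n) k → Vec (Dom M) n → Vec A k
      ⟦ [] ⟧ˢ     v = []
      ⟦ φ ∷ φs ⟧ˢ v = ⟦ φ ⟧ v ∷ ⟦ φs ⟧ˢ v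

  infix 4 _⊨_[_] _⊨ᵀ_ _⨟_⊨_

  _⊨_[_] : (M : Structure) → ∀ {n} → Pred (Formula n) ℓ → Vec (Dom M) n → Set ℓ
  M ⊨ Φ [ d ] = ∀ {φ} → φ ∈ᵖ Φ → ⟦_⟧ M φ d ≡ 1#

  _⊨ᵀ_ : Structure → Theory → Set ℓ
  M ⊨ᵀ T = M ⊨ T [ [] ]

  _⨟_⊨_ : Theory → ∀ {n} → Pred (Formula n) ℓ → Pred (Formula n) ℓ → Set (lsuc ℓ)
  T ⨟ Φ ⊨ Θ = (M : Structure) → M ⊨ᵀ T →
              ∀ d → M ⊨ Φ [ d ] → M ⊨ Θ [ d ]

  -- A substructure of N is given by a nonempty subset of its domain closed
  -- under the functions.  Membership is proof-irrelevant, so that elements of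
  -- `induced` are equal exactly when they are equal in N.
  record Substructure (N : Structure) : Set (lsuc ℓ) where
    open Structure N using (func; pred)
    field
      Member     : Pred (Dom N) ℓ
      irrelevant : ∀ x → Irrelevant (Member x)
      nonempty   : ∃ Member
      closed     : ∀ {k} (F : Func k) (xs : Vec (∃ Member) k) →
                   Member (func F (map proj₁ xs))

    induced : Structure
    induced = record
      { Dom      = ∃ Member
      ; nonempty = nonempty
      ; func     = λ F xs → func F (map proj₁ xs) , closed F xs
      ; pred     = λ P xs → pred P (map proj₁ xs)
      }

  open Substructure public using (induced)

  PreservedUnderSubstructures : Theory → ∀ {n} → Pred (Formula n) ℓ → Set (lsuc ℓ)
  PreservedUnderSubstructures T {n} Φ =
    (N : Structure) (S : Substructure N) → induced S ⊨ᵀ T → N ⊨ᵀ T →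
    (d : Vec (Dom (induced S)) n) →
    N ⊨ Φ [ map proj₁ d ] → induced S ⊨ Φ [ d ]

  UniversallyAxiomatised : Theory → ∀ {n} → Pred (Formula n) ℓ → Set (lsuc ℓ)
  UniversallyAxiomatised T {n} Φ =
    ∃ λ (Θ : Pred (Formula n) ℓ) →
      (∀ {θ} → θ ∈ᵖ Θ → Universal θ) × (T ⨟ Φ ⊨ Θ) × (T ⨟ Θ ⊨ Φ)

{-# OPTIONS --safe #-}

-- Take for Θ the universal consequences of T and Φ, and let M satisfy T and, at d, Θ.
-- Every finite part of the diagram of M, with d named, is realised in a model of T and
-- Φ: otherwise its conjunction χ would only take values up to the coatom k there, and
-- the closure of χ ⇒ k would be in Θ although it fails in M.  An ultraproduct of these
-- models satisfies T and Φ (Łoś; suprema and infima are attained because 𝐀 is finite)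
-- and contains a copy of M, to which Φ descends by preservation.

module Submission where

open import Algebra.Structures using (IsCommutativeMonoid)
open import Axiom.ExcludedMiddle using (ExcludedMiddle)
open import Data.Bool.Properties using (T-irrelevant)
open import Data.Empty using (⊥)
open import Data.Fin.Base using (Fin; zero; suc; _↑ˡ_; _↑ʳ_)
open import Data.List.Base as List using (List; []; _∷_; _++_)
open import Data.List.Membership.Propositional using (_∈_; lose)
open import Data.List.Membership.Propositional.Properties using (∈-concatMap⁺)
open import Data.List.Relation.Binary.Subset.Propositional using () renaming (_⊆_ to _⊆ₗ_)
open import Data.List.Relation.Unary.All as All using (All; []; _∷_)
open import Data.List.Relation.Unary.All.Properties using (++⁺; ++⁻)
open import Data.List.Relation.Unary.Any using (here; there; index)
open import Data.Nat.Base using (ℕ; zero; suc; _+_)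
open import Data.Product.Base using (Σ; ∃; _×_; _,_; proj₁; proj₂)
open import Data.Sum.Base using (_⊎_; inj₁; inj₂)
open import Data.Vec.Base as Vec using (Vec; []; _∷_; lookup; map)
open import Data.Vec.Properties
  using (lookup-map; map-∘; map-id; tabulate∘lookup; tabulate-cong; lookup-++ˡ; lookup-++ʳ)
open import Data.Vec.Relation.Unary.All as VecAll using ([]; _∷_)
open import Function.Base using (_∘_; id; flip)
open import Function.Bundles using (_⇔_; mk⇔; Inverse)
open import Level using (Lift; lift; lower; _⊔_; 0ℓ) renaming (suc to lsuc)
open import Relation.Binary.Bundles using (Poset)
import Relation.Binary.Construct.On as On
open import Relation.Binary.Core using (Rel)
open import Relation.Binary.Definitions using (Total)
open import Relation.Binary.Lattice.Structures using (IsBoundedLattice)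
open import Relation.Binary.PropositionalEquality
  using (_≡_; _≢_; refl; sym; trans; cong; cong₂; subst)
open import Relation.Binary.Structures using (IsEquivalence)
open import Relation.Nullary.Decidable
  using (Dec; yes; no; True; toWitness; fromWitness; decidable-stable)
open import Relation.Nullary.Irrelevant using (Irrelevant)
open import Relation.Nullary.Negation using (¬_; contradiction)
open import Relation.Unary using (Pred; _⊆_; _∩_; ∁)
open import Relation.Unary.Relation.Binary.Subset using (⊆-poset)
open import Defs

-- The formula χ ⇒ 0 could not replace χ ⇒ k: a conjunction that misses 1 may still take a value
-- strictly above 0. Finiteness of the chain yields a largest value k below 1, and its truth
-- constant makes χ ⇒ k fully true exactly where χ is not. Truth constants also let the diagram
-- record the exact value of every predicate. The language is never expanded by names for the
-- elements of M. A finite part of the diagram is written in variables, and a map from M into the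
-- realising model takes over the role of the interpreted names. Equality in a structure is
-- propositional equality, so the ultraproduct lives on a transversal of representatives. Θ
-- quantifies over all structures and would land one universe too high; excluded middle brings it
-- down.

-- Ultrafilters and quotients.

record Ultrafilter {ℓ} (I : Set ℓ) : Set (lsuc ℓ) where
  field
    Large     : Pred (Pred I ℓ) 0ℓ
    upward    : ∀ {P Q} → P ⊆ Q → Large P → Large Q
    meet      : ∀ {P Q} → Large P → Large Q → Large (P ∩ Q)
    inhabited : ∀ {P} → Large P → ∃ P
    dichotomy : ∀ P → Large P ⊎ Large (∁ P)

  meet-with : ∀ {P Q R} → P ∩ Q ⊆ R → Large P → Large Q → Large R
  meet-with P∩Q⊆R p q = upward P∩Q⊆R (meet p q)

  -- Largeness of the whole index set is not postulated: by `dichotomy` the alternative is a large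
  -- empty set, against `inhabited`.
  everywhere : ∀ {P} → (∀ i → P i) → Large P
  everywhere {P} p with dichotomy P
  ... | inj₁ large = large
  ... | inj₂ small = let i , ¬Pi = inhabited small in contradiction (p i) ¬Pi

  meet-finite : ∀ {n} {P : Fin n → Pred I ℓ} → (∀ j → Large (P j)) → Large (λ i → ∀ j → P j i)
  meet-finite {zero}  ps = everywhere λ _ ()
  meet-finite {suc n} ps = meet-with (λ (p , q) → λ { zero → p ; (suc j) → q j })
    (ps zero) (meet-finite (ps ∘ suc))

-- Each class carries its chosen representative, so operations defined through `rep` need no proof
-- of independence of the choice.
record Quotient {x r} {X : Set x} (_∼_ : Rel X r) : Set (lsuc x ⊔ r) where
  field
    Class         : Set x
    rep           : Class → X
    class         : X → Class
    class-rep     : ∀ x → x ∼ rep (class x)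
    rep-separated : ∀ {p q} → rep p ∼ rep q → p ≡ q

-- Maximal sets, ultrafilters and transversals from Zorn's lemma.

module Choice (em : ∀ {a} → ExcludedMiddle a)
              (zorn : ∀ {c ℓ₁ ℓ₂ p} → Zorn c ℓ₁ ℓ₂ p) where

  by-contradiction : ∀ {a} {P : Set a} → ¬ ¬ P → P
  by-contradiction = decidable-stable em

  -- Excluded middle provides propositional resizing: a proof-irrelevant copy of
  -- any proposition at any level.
  Resize : ∀ {a} b → Set a → Set b
  Resize b P = Lift b (True (em {P = P}))

  resize : ∀ {a b} {P : Set a} → P → Resize b P
  resize p = lift (fromWitness p)

  unresize : ∀ {a b} {P : Set a} → Resize b P → P
  unresize p = toWitness (lower p)

  resize-irrelevant : ∀ {a b} {P : Set a} → Irrelevant (Resize b P)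
  resize-irrelevant (lift p) (lift q) = cong lift (T-irrelevant p q)

  -- The Teichmüller–Tukey lemma, for the subsets all of whose finite lists of
  -- elements satisfy Con.
  tukey : ∀ {x b c} {X : Set x} (Con : Pred (List X) c) →
          (∀ {xs ys} → xs ⊆ₗ ys → Con ys → Con xs) →
          (B : Pred X b) → (∀ {xs} → All B xs → Con xs) →
          ∃ λ (S : Pred X 0ℓ) → (B ⊆ S) × (∀ {xs} → All S xs → Con xs) ×
            (∀ {x} → (∀ {ys} → All S ys → Con (x ∷ ys)) → S x)
  tukey {X = X} Con anti B B-con
    with zorn {p = 0ℓ} extensions chain-bound
    where
    Extension : Set _
    Extension = ∃ λ (S : Pred X 0ℓ) → (B ⊆ S) × (∀ {xs} → All S xs → Con xs)

    extensions : Poset _ _ _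
    extensions = On.poset (⊆-poset X 0ℓ) (proj₁ {B = λ S → (B ⊆ S) × (∀ {xs} → All S xs → Con xs)})

    chain-bound : (C : Pred Extension 0ℓ) →
      (∀ {E F} → C E → C F → proj₁ E ⊆ proj₁ F ⊎ proj₁ F ⊆ proj₁ E) →
      ∃ λ (U : Extension) → ∀ {E} → C E → proj₁ E ⊆ proj₁ U
    chain-bound C compare = (⋃C , resize ∘ inj₁ , con) , λ E∈C x∈E → resize (inj₂ (_ , E∈C , x∈E))
      where
      -- `B` is adjoined so that the empty chain has a bound as well. The union runs over
      -- extensions, which live in a higher universe, hence `Resize`.
      ⋃C : Pred X 0ℓ
      ⋃C x = Resize 0ℓ (B x ⊎ ∃ λ E → C E × proj₁ E x)

      -- Finitely many elements involve finitely many members of the chain, and the largest of these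
      -- contains them all. A list taken entirely from `B` may involve none.
      absorbed : ∀ {xs} → All ⋃C xs → All B xs ⊎ ∃ λ E → C E × All (proj₁ E) xs
      absorbed []       = inj₁ []
      absorbed (p ∷ ps) with unresize p | absorbed ps
      ... | inj₁ b             | inj₁ bs             = inj₁ (b ∷ bs)
      ... | inj₁ b             | inj₂ (E , E∈C , es) = inj₂ (E , E∈C , proj₁ (proj₂ E) b ∷ es)
      ... | inj₂ (E , E∈C , e) | inj₁ bs             = inj₂ (E , E∈C , e ∷ All.map (proj₁ (proj₂ E)) bs)
      ... | inj₂ (E , E∈C , e) | inj₂ (F , F∈C , fs) with compare E∈C F∈C
      ...   | inj₁ E⊆F = inj₂ (F , F∈C , E⊆F e ∷ fs)
      ...   | inj₂ F⊆E = inj₂ (E , E∈C , e ∷ All.map F⊆E fs)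

      con : ∀ {xs} → All ⋃C xs → Con xs
      con ps with absorbed ps
      ... | inj₁ bs           = B-con bs
      ... | inj₂ (E , _ , es) = proj₂ (proj₂ E) es
  ... | (S , B⊆S , S-con) , maximal = S , B⊆S , S-con , saturated
    where
    -- Adjoining `x` to `S` gives another extension, and maximality puts `x` back into `S`.
    saturated : ∀ {x} → (∀ {ys} → All S ys → Con (x ∷ ys)) → S x
    saturated {x} x-con = maximal {S+x , resize ∘ inj₁ ∘ B⊆S , con} (resize ∘ inj₁) (resize (inj₂ refl))
      where
      S+x : Pred X 0ℓ
      S+x y = Resize 0ℓ (S y ⊎ y ≡ x)

      split : ∀ {ys} → All S+x ys → ∃ λ zs → All S zs × ys ⊆ₗ (x ∷ zs)
      split []       = [] , [] , λ ()
      split (p ∷ ps) with unresize p | split ps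
      ... | inj₁ s    | zs , ss , ys⊆ = _ ∷ zs , s ∷ ss ,
              λ { (here refl) → there (here refl)
                ; (there y∈)  → keep (ys⊆ y∈) }
        where
        keep : ∀ {y z} → y ∈ x ∷ zs → y ∈ x ∷ z ∷ zs
        keep (here eq)  = here eq
        keep (there y∈) = there (there y∈)
      ... | inj₂ refl | zs , ss , ys⊆ = zs , ss , λ { (here eq) → here eq ; (there y∈) → ys⊆ y∈ }

      con : ∀ {ys} → All S+x ys → Con ys
      con ps with split ps
      ... | _ , ss , ys⊆ = anti ys⊆ (x-con ss)

  -- An ultrafilter is a maximal family with the finite intersection property. By saturation a set
  -- is large once it is compatible with every finite list of large sets, so each field becomes a
  -- statement about finite intersections.
  ultrafilter : ∀ {ℓ} {I : Set ℓ} (B : Pred (Pred I ℓ) ℓ) →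
                (∀ {Ps} → All B Ps → ∃ λ i → All (λ P → P i) Ps) →
                ∃ λ (𝒰 : Ultrafilter I) → B ⊆ Ultrafilter.Large 𝒰
  ultrafilter {ℓ} {I} B B-fip
    with tukey (λ Ps → ∃ λ i → All (λ P → P i) Ps)
               (λ Ps⊆Qs (i , qs) → i , All.tabulate (All.lookup qs ∘ Ps⊆Qs)) B B-fip
  ... | Large , B⊆ , fip , saturated = record
      { Large     = Large
      ; upward    = λ P⊆Q p → saturated λ qs → weaken P⊆Q (fip (p ∷ qs))
      ; meet      = λ p q → saturated λ rs → merge (fip (p ∷ q ∷ rs))
      ; inhabited = λ p → let i , ps = fip (p ∷ []) in i , All.head ps
      ; dichotomy = dichotomy
      } , B⊆
    where
    weaken : ∀ {P Q : Pred I ℓ} {Rs} → P ⊆ Q →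
             (∃ λ i → All (λ R → R i) (P ∷ Rs)) → ∃ λ i → All (λ R → R i) (Q ∷ Rs)
    weaken P⊆Q (i , p ∷ rs) = i , P⊆Q p ∷ rs

    merge : ∀ {P Q : Pred I ℓ} {Rs} →
            (∃ λ i → All (λ R → R i) (P ∷ Q ∷ Rs)) → ∃ λ i → All (λ R → R i) (P ∩ Q ∷ Rs)
    merge (i , p ∷ q ∷ rs) = i , (p , q) ∷ rs

    dichotomy : ∀ P → Large P ⊎ Large (∁ P)
    dichotomy P with em {P = Large P}
    ... | yes p = inj₁ p
    -- If the large sets `Qs` had no common point outside `P`, their intersection would lie inside
    -- `P`; then `P` would be compatible with every list `Rs` of large sets, hence large.
    ... | no ¬p = inj₂ (saturated λ {Qs} qs → by-contradiction λ disjoint →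
            ¬p (saturated λ {Rs} rs → inside disjoint (fip (++⁺ qs rs))))
      where
      inside : ∀ {Qs Rs} → ¬ (∃ λ i → All (λ R → R i) (∁ P ∷ Qs)) →
               (∃ λ i → All (λ R → R i) (Qs ++ Rs)) → ∃ λ i → All (λ R → R i) (P ∷ Rs)
      inside {Qs} disjoint (i , qrs) with ++⁻ Qs qrs
      ... | qs , rs = i , by-contradiction (λ ¬Pi → disjoint (i , ¬Pi ∷ qs)) ∷ rs

  -- Finitely many cones share a point: the list of their tips. The resulting ultrafilter makes each
  -- `x` a member of almost every list.
  cone-ultrafilter : ∀ {ℓ} (X : Set ℓ) → ∃ λ (𝒰 : Ultrafilter (List X)) →
    ∀ x {P} → (∀ {xs} → x ∈ xs → P xs) → Ultrafilter.Large 𝒰 P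
  cone-ultrafilter {ℓ} X = let 𝒰 , cones = ultrafilter Cone (λ cs → tips cs , meets cs id) in
    𝒰 , λ x p → cones (x , p)
    where
    Cone : Pred (Pred (List X) ℓ) ℓ
    Cone P = ∃ λ x → ∀ {xs} → x ∈ xs → P xs

    tips : ∀ {Ps} → All Cone Ps → List X
    tips []             = []
    tips ((x , _) ∷ cs) = x ∷ tips cs

    meets : ∀ {Ps xs} (cs : All Cone Ps) → tips cs ⊆ₗ xs → All (λ P → P xs) Ps
    meets []             _    = []
    meets ((_ , p) ∷ cs) ⊆xs = p (⊆xs (here refl)) ∷ meets cs (⊆xs ∘ there)

  -- Being separated is a condition on pairs, hence of finite character. A maximal separated set
  -- meets every class, since an unrepresented element could still be adjoined.
  transversal : ∀ {x r} {X : Set x} {_∼_ : Rel X r} → IsEquivalence _∼_ →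
                ∃ λ (S : Pred X 0ℓ) → (∀ {x y} → S x → S y → x ∼ y → x ≡ y) ×
                                       (∀ x → ∃ λ y → S y × x ∼ y)
  transversal {X = X} {_∼_} isEquivalence
    with tukey (λ xs → ∀ {x y} → x ∈ xs → y ∈ xs → x ∼ y → x ≡ y)
               (λ xs⊆ys separated x∈ y∈ → separated (xs⊆ys x∈) (xs⊆ys y∈)) (λ _ → ⊥) nothing
    where
    nothing : ∀ {xs : List X} → All (λ _ → ⊥) xs → ∀ {x y} → x ∈ xs → y ∈ xs → x ∼ y → x ≡ y
    nothing [] ()
  ... | S , _ , separated , saturated =
        S , (λ x∈ y∈ → separated (x∈ ∷ y∈ ∷ []) (here refl) (there (here refl))) , represent
    where
    open IsEquivalence isEquivalence renaming (refl to ∼-refl; sym to ∼-sym)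

    represent : ∀ x → ∃ λ y → S y × x ∼ y
    represent x = by-contradiction λ unrepresented →
      unrepresented (x , saturated (extend unrepresented) , ∼-refl)
      where
      extend : ¬ (∃ λ y → S y × x ∼ y) → ∀ {ys} → All S ys →
               ∀ {y z} → y ∈ x ∷ ys → z ∈ x ∷ ys → y ∼ z → y ≡ z
      extend _  _  (here refl) (here refl) _   = refl
      extend ∄y ss (here refl) (there z∈)  y∼z = contradiction (_ , All.lookup ss z∈ , y∼z) ∄y
      extend ∄y ss (there y∈)  (here refl) y∼z = contradiction (_ , All.lookup ss y∈ , ∼-sym y∼z) ∄y
      extend _  ss (there y∈)  (there z∈)  y∼z = separated ss y∈ z∈ y∼z

  quotient : ∀ {x r} {X : Set x} {_∼_ : Rel X r} → IsEquivalence _∼_ → Quotient _∼_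
  quotient {X = X} {_∼_} isEquivalence with transversal isEquivalence
  ... | S , separated , represent = record
      -- `S` may have several proofs of membership; the resized copy has at most one, so a class is
      -- determined by its representative.
      { Class         = ∃ λ x → Resize 0ℓ (S x)
      ; rep           = proj₁
      ; class         = λ x → let y , y∈ , _ = represent x in y , resize y∈
      ; class-rep     = λ x → proj₂ (proj₂ (represent x))
      ; rep-separated = separate
      }
    where
    separate : ∀ {p q : ∃ λ x → Resize 0ℓ (S x)} → proj₁ p ∼ proj₁ q → p ≡ q
    separate {x , x∈} {y , y∈} x∼y with refl ← separated (unresize x∈) (unresize y∈) x∼y =
      cong (x ,_) (resize-irrelevant x∈ y∈)

-- Attained extrema and residuation in a finite chain.

module Chain {ℓ} (em : ExcludedMiddle ℓ) (𝐀 : FiniteMTLChain ℓ) where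
  open FiniteMTLChain 𝐀 renaming (Carrier to A)
  open IsBoundedLattice isBoundedLattice
    using (maximum; minimum; x∧y≤x; x∧y≤y; ∧-greatest)
    renaming (refl to ≤-refl; reflexive to ≤-reflexive; trans to ≤-trans; antisym to ≤-antisym) public
  open Bounds em 𝐀

  -- R is ≤ or its converse.
  extremal-index : (R : Rel A ℓ) → (∀ {a} → R a a) → (∀ {a b c} → R a b → R b c → R a c) → Total R →
    ∀ {n} (g : Fin n → A) (P : Pred A ℓ) → ∃ (P ∘ g) →
    ∃ λ k → P (g k) × ∀ j → P (g j) → R (g k) (g j)
  extremal-index R R-refl R-trans R-total {suc n} g P (k₀ , p₀) with em {Lift ℓ (∃ (P ∘ g ∘ suc))}
  ... | no none with k₀
  ...   | suc k = contradiction (lift (k , p₀)) none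
  ...   | zero  = zero , p₀ , λ
          { zero    _ → R-refl
          ; (suc j) p → contradiction (lift (j , p)) none }
  extremal-index R R-refl R-trans R-total {suc n} g P _ | yes (lift some)
    with extremal-index R R-refl R-trans R-total (g ∘ suc) P some | em {P (g zero)}
  ... | k , p , R-k | no ¬p₀ = suc k , p , λ
          { zero    p₀ → contradiction p₀ ¬p₀
          ; (suc j) q  → R-k j q }
  ... | k , p , R-k | yes p₀ with R-total (g zero) (g (suc k))
  ...   | inj₁ R₀ₖ = zero , p₀ , λ { zero _ → R-refl ; (suc j) q → R-trans R₀ₖ (R-k j q) }
  ...   | inj₂ Rₖ₀ = suc k , p , λ { zero _ → Rₖ₀ ; (suc j) q → R-k j q }

  module _ (R : Rel A ℓ) (R-refl : ∀ {a} → R a a) (R-trans : ∀ {a b c} → R a b → R b c → R a c)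
           (R-total : Total R) {D : Set ℓ} (f : D → A) where
    private
      module F = Inverse (proj₂ finite)

    -- `D` may be infinite, so the search runs over the finite enumeration of truth values,
    -- restricted to those that `f` attains.
    extremal-argument : D → ∃ λ d₀ → ∀ d → R (f d₀) (f d)
    extremal-argument d₁
      with extremal-index R R-refl R-trans R-total F.to (λ a → ∃ λ d → f d ≡ a)
             (F.from (f d₁) , d₁ , sym (F.strictlyInverseˡ (f d₁)))
    ... | k , (d₀ , fd₀≡) , best = d₀ , λ d →
          subst (λ a → R a (f d)) (sym fd₀≡)
            (subst (R (F.to k)) (F.strictlyInverseˡ (f d))
              (best (F.from (f d)) (d , sym (F.strictlyInverseˡ (f d)))))

  module _ {D : Set ℓ} (f : D → A) where

    ⋀-lower : ∀ d → ⋀ f ≤ f d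
    ⋀-lower = proj₁ (proj₂ (infimum f))

    ⋀-greatest : ∀ {l} → (∀ d → l ≤ f d) → l ≤ ⋀ f
    ⋀-greatest = proj₂ (proj₂ (infimum f)) _

    ⋁-upper : ∀ d → f d ≤ ⋁ f
    ⋁-upper = proj₁ (proj₂ (supremum f))

    ⋁-least : ∀ {u} → (∀ d → f d ≤ u) → ⋁ f ≤ u
    ⋁-least = proj₂ (proj₂ (supremum f)) _

    ⋀-attained : D → ∃ λ d → f d ≡ ⋀ f
    ⋀-attained d₁ with extremal-argument _≤_ ≤-refl ≤-trans total f d₁
    ... | d , least = d , ≤-antisym (⋀-greatest least) (⋀-lower d)

    ⋁-attained : D → ∃ λ d → f d ≡ ⋁ f
    ⋁-attained d₁ with extremal-argument (flip _≤_) ≤-refl (flip ≤-trans) (flip total) f d₁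
    ... | d , greatest = d , ≤-antisym (⋁-upper d) (⋁-least greatest)

  -- The supremum of the values other than `1#` is attained, so it is one of them; `0≢1` makes this
  -- family nonempty.
  coatom : 0# ≢ 1# → ∃ λ k → k ≢ 1# × ∀ {a} → a ≢ 1# → a ≤ k
  coatom 0≢1 with ⋁-attained {D = ∃ (_≢ 1#)} proj₁ (0# , 0≢1)
  ... | (k , k≢1) , k≡⋁ = k , k≢1 , λ {a} a≢1 →
        subst (a ≤_) (sym k≡⋁) (⋁-upper proj₁ (a , a≢1))

  1≤⇒≡1 : ∀ {a} → 1# ≤ a → a ≡ 1#
  1≤⇒≡1 = ≤-antisym (maximum _)

  ⇒≡1⇒≤ : ∀ {a b} → a ⇒ b ≡ 1# → a ≤ b
  ⇒≡1⇒≤ {a} {b} eq = subst (_≤ b) (IsCommutativeMonoid.identityˡ isCommutativeMonoid a)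
    (proj₂ (residuated 1# a b) (≤-reflexive (sym eq)))

  ≤⇒⇒≡1 : ∀ {a b} → a ≤ b → a ⇒ b ≡ 1#
  ≤⇒⇒≡1 {a} {b} a≤b = 1≤⇒≡1 (proj₁ (residuated 1# a b)
    (subst (_≤ b) (sym (IsCommutativeMonoid.identityˡ isCommutativeMonoid a)) a≤b))

  ∧≡1⇒ : ∀ {a b} → a ∧ b ≡ 1# → a ≡ 1# × b ≡ 1#
  ∧≡1⇒ {a} {b} eq = 1≤⇒≡1 (subst (_≤ a) eq (x∧y≤x a b)) , 1≤⇒≡1 (subst (_≤ b) eq (x∧y≤y a b))

  ⇒∧≡1 : ∀ {a b} → a ≡ 1# → b ≡ 1# → a ∧ b ≡ 1#
  ⇒∧≡1 refl refl = 1≤⇒≡1 (∧-greatest ≤-refl ≤-refl)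

  ⋀-cong : ∀ {D E : Set ℓ} {f : D → A} {g : E → A} →
           (∀ d → ∃ λ e → f d ≡ g e) → (∀ e → ∃ λ d → f d ≡ g e) → ⋀ f ≡ ⋀ g
  ⋀-cong {f = f} {g} f⇒g g⇒f = ≤-antisym
    (⋀-greatest g λ e → let d , eq = g⇒f e in subst (⋀ f ≤_) eq (⋀-lower f d))
    (⋀-greatest f λ d → let e , eq = f⇒g d in subst (⋀ g ≤_) (sym eq) (⋀-lower g e))

  ⋁-cong : ∀ {D E : Set ℓ} {f : D → A} {g : E → A} →
           (∀ d → ∃ λ e → f d ≡ g e) → (∀ e → ∃ λ d → f d ≡ g e) → ⋁ f ≡ ⋁ g
  ⋁-cong {f = f} {g} f⇒g g⇒f = ≤-antisym
    (⋁-least f λ d → let e , eq = f⇒g d in subst (_≤ ⋁ g) (sym eq) (⋁-upper g e))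
    (⋁-least g λ e → let d , eq = g⇒f e in subst (_≤ ⋁ f) eq (⋁-upper f d))

-- Embeddings and the descent of universal formulas.

module Embeddings {ℓ} (em : ExcludedMiddle ℓ) (𝐀 : FiniteMTLChain ℓ) (𝒫 : Language ℓ) where
  open FiniteMTLChain 𝐀 using (1#; _≤_; interp; _∧_; _∨_; _&_; _⇒_)
  open Language 𝒫
  open Semantics em 𝐀 𝒫
  open Chain em 𝐀

  crisp-cong : ∀ {P Q : Set ℓ} (P? : Dec P) (Q? : Dec Q) → (P → Q) → (Q → P) → crisp P? ≡ crisp Q?
  crisp-cong (yes _) (yes _) _   _   = refl
  crisp-cong (yes p) (no ¬q) P→Q _   = contradiction (P→Q p) ¬q
  crisp-cong (no ¬p) (yes q) _   Q→P = contradiction (Q→P q) ¬p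
  crisp-cong (no _)  (no _)  _   _   = refl

  record Embedding (M N : Structure) : Set ℓ where
    private
      module M = Structure M
      module N = Structure N
    field
      to        : Dom M → Dom N
      injective : ∀ {x y} → to x ≡ to y → x ≡ y
      func-homo : ∀ {k} (F : Func k) xs → to (M.func F xs) ≡ N.func F (map to xs)
      pred-homo : ∀ {k} (P : Pr k) xs → M.pred P xs ≡ N.pred P (map to xs)

    mutual
      term-homo : ∀ {n} (t : Term n) v → to (⟦_⟧ᵗ M t v) ≡ ⟦_⟧ᵗ N t (map to v)
      term-homo (var i)    v = sym (lookup-map i to v)
      term-homo (fun F ts) v = trans (func-homo F _) (cong (N.func F) (terms-homo ts v))

      terms-homo : ∀ {n k} (ts : Vec (Term n) k) v → map to (⟦_⟧ᵗˢ M ts v) ≡ ⟦_⟧ᵗˢ N ts (map to v)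
      terms-homo []       v = refl
      terms-homo (t ∷ ts) v = cong₂ _∷_ (term-homo t v) (terms-homo ts v)

    Absolute : ∀ {n} → Pred (Formula n) ℓ
    Absolute φ = ∀ v → ⟦_⟧ M φ v ≡ ⟦_⟧ N φ (map to v)

    pr-absolute : ∀ {n k} (P : Pr k) (ts : Vec (Term n) k) → Absolute (pr P ts)
    pr-absolute P ts v = trans (pred-homo P _) (cong (N.pred P) (terms-homo ts v))

    ≈̇-absolute : ∀ {n} (s t : Term n) → Absolute (s ≈̇ t)
    ≈̇-absolute s t v = crisp-cong em em
      (λ eq → trans (sym (term-homo s v)) (trans (cong to eq) (term-homo t v)))
      (λ eq → injective (trans (term-homo s v) (trans eq (sym (term-homo t v)))))

    mutual
      quantifierFree-absolute : ∀ {n} {φ : Formula n} → QuantifierFree φ → Absolute φ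
      quantifierFree-absolute (pr P ts) v = pr-absolute P ts v
      quantifierFree-absolute (s ≈̇ t)   v = ≈̇-absolute s t v
      quantifierFree-absolute (const a) v = refl
      quantifierFree-absolute (p ∧̇ q)   v = cong₂ _∧_ (quantifierFree-absolute p v) (quantifierFree-absolute q v)
      quantifierFree-absolute (p ∨̇ q)   v = cong₂ _∨_ (quantifierFree-absolute p v) (quantifierFree-absolute q v)
      quantifierFree-absolute (p &̇ q)   v = cong₂ _&_ (quantifierFree-absolute p v) (quantifierFree-absolute q v)
      quantifierFree-absolute (p ⇒̇ q)   v = cong₂ _⇒_ (quantifierFree-absolute p v) (quantifierFree-absolute q v)
      quantifierFree-absolute (op o ps) v = cong (interp o) (quantifierFrees-absolute ps v)

      quantifierFrees-absolute : ∀ {n k} {φs : Vec (Formula n) k} → VecAll.All QuantifierFree φs →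
        ∀ v → ⟦_⟧ˢ M φs v ≡ ⟦_⟧ˢ N φs (map to v)
      quantifierFrees-absolute []       v = refl
      quantifierFrees-absolute (p ∷ ps) v = cong₂ _∷_ (quantifierFree-absolute p v) (quantifierFrees-absolute ps v)

    -- The infimum in `N` runs over the images of the elements of `M` and possibly more, so it can
    -- only be lower.
    universal-reflected : ∀ {n} {φ : Formula n} → Universal φ → ∀ v → ⟦_⟧ N φ (map to v) ≤ ⟦_⟧ M φ v
    universal-reflected (matrix p) v = ≤-reflexive (sym (quantifierFree-absolute p v))
    universal-reflected (∀̇ u)      v = ⋀-greatest _ λ d →
      ≤-trans (⋀-lower _ (to d)) (universal-reflected u (d ∷ v))

    module _ (surjective : ∀ y → ∃ λ x → to x ≡ y) where
      mutual
        absolute : ∀ {n} (φ : Formula n) → Absolute φ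
        absolute (pr P ts) v = pr-absolute P ts v
        absolute (s ≈̇ t)   v = ≈̇-absolute s t v
        absolute (const a) v = refl
        absolute (φ ∧̇ ψ)   v = cong₂ _∧_ (absolute φ v) (absolute ψ v)
        absolute (φ ∨̇ ψ)   v = cong₂ _∨_ (absolute φ v) (absolute ψ v)
        absolute (φ &̇ ψ)   v = cong₂ _&_ (absolute φ v) (absolute ψ v)
        absolute (φ ⇒̇ ψ)   v = cong₂ _⇒_ (absolute φ v) (absolute ψ v)
        absolute (op o φs) v = cong (interp o) (absolutes φs v)
        absolute (∀̇ φ)     v = ⋀-cong (λ x → to x , absolute φ (x ∷ v)) (absolute-above φ v)
        absolute (∃̇ φ)     v = ⋁-cong (λ x → to x , absolute φ (x ∷ v)) (absolute-above φ v)

        absolutes : ∀ {n k} (φs : Vec (Formula n) k) v → ⟦_⟧ˢ M φs v ≡ ⟦_⟧ˢ N φs (map to v)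
        absolutes []       v = refl
        absolutes (φ ∷ φs) v = cong₂ _∷_ (absolute φ v) (absolutes φs v)

        absolute-above : ∀ {n} (φ : Formula (suc n)) v y →
          ∃ λ x → ⟦_⟧ M φ (x ∷ v) ≡ ⟦_⟧ N φ (y ∷ map to v)
        absolute-above φ v y with surjective y
        ... | x , refl = x , absolute φ (x ∷ v)

  inclusion : ∀ {N} (S : Substructure N) → Embedding (induced S) N
  inclusion S = record
    { to        = proj₁
    ; injective = λ { {x , x∈} {_ , y∈} refl → cong (x ,_) (Substructure.irrelevant S x x∈ y∈) }
    ; func-homo = λ F xs → refl
    ; pred-homo = λ P xs → refl
    }

  -- `Θ` mediates: `Φ` yields it in `N`, its universal formulas descend to the substructure, and
  -- there it yields `Φ` again.
  universallyAxiomatised⇒preserved : ∀ {T n} {Φ : Pred (Formula n) ℓ} →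
    UniversallyAxiomatised T Φ → PreservedUnderSubstructures T Φ
  universallyAxiomatised⇒preserved (Θ , universal , Φ⊨Θ , Θ⊨Φ) N S S⊨T N⊨T d N⊨Φ =
    Θ⊨Φ (induced S) S⊨T d λ {θ} θ∈Θ →
      1≤⇒≡1 (subst (_≤ ⟦_⟧ (induced S) θ d) (Φ⊨Θ N N⊨T (map proj₁ d) N⊨Φ θ∈Θ)
        (Embedding.universal-reflected (inclusion S) (universal θ∈Θ) d))

-- Images of embeddings as substructures.

module Images (em : ∀ {a} → ExcludedMiddle a) (zorn : ∀ {c ℓ₁ ℓ₂ p} → Zorn c ℓ₁ ℓ₂ p)
              {ℓ} (𝐀 : FiniteMTLChain ℓ) (𝒫 : Language ℓ) where
  open Choice em zorn
  open Semantics em 𝐀 𝒫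
  open Embeddings em 𝐀 𝒫

  module _ {M N : Structure} (h : Embedding M N) where
    open Embedding h
    private
      module M = Structure M
      module N = Structure N

    image : Substructure N
    image = record
      { Member     = Image
      ; irrelevant = λ _ → resize-irrelevant
      ; nonempty   = to M.nonempty , resize (M.nonempty , refl)
      ; closed     = λ F xs → resize (M.func F (map preimage xs) ,
          trans (func-homo F _) (cong (N.func F) (to-preimages xs)))
      }
      where
      Image : Pred (Dom N) ℓ
      -- Resizing provides the proof irrelevance that `Substructure` demands; the preimage can still
      -- be recovered.
      Image y = Resize ℓ (∃ λ x → to x ≡ y)

      preimage : ∃ Image → Dom M
      preimage (_ , y∈) = proj₁ (unresize y∈)

      to-preimages : ∀ {k} (ys : Vec (∃ Image) k) → map to (map preimage ys) ≡ map proj₁ ys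
      to-preimages []              = refl
      to-preimages ((y , y∈) ∷ ys) = cong₂ _∷_ (proj₂ (unresize y∈)) (to-preimages ys)

    onto-image : Embedding M (induced image)
    onto-image = record
      { to        = λ x → to x , resize (x , refl)
      ; injective = injective ∘ cong proj₁
      ; func-homo = λ F xs → injective-inclusion (trans (func-homo F xs) (cong (N.func F) (map-∘ proj₁ _ xs)))
      ; pred-homo = λ P xs → trans (pred-homo P xs) (cong (N.pred P) (map-∘ proj₁ _ xs))
      }
      where
      injective-inclusion = Embedding.injective (inclusion image)

    onto-image-surjective : ∀ y → ∃ λ x → Embedding.to onto-image x ≡ y
    onto-image-surjective (_ , y∈) with unresize y∈
    ... | x , refl = x , Embedding.injective (inclusion image) refl

-- Ultraproducts over a finite chain and Łoś's theorem.

module Ultraproducts (em : ∀ {a} → ExcludedMiddle a) (zorn : ∀ {c ℓ₁ ℓ₂ p} → Zorn c ℓ₁ ℓ₂ p)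
                     {ℓ} (𝐀 : FiniteMTLChain ℓ) (𝒫 : Language ℓ) where
  open Choice em zorn
  open FiniteMTLChain 𝐀 using (_≤_; interp; finite; _∧_; _∨_; _&_; _⇒_) renaming (Carrier to A)
  open Language 𝒫
  open Semantics em 𝐀 𝒫
  open Chain em 𝐀
  open Embeddings em 𝐀 𝒫 using (crisp-cong)

  module _ {I : Set ℓ} (𝒰 : Ultrafilter I) (N : I → Structure) where
    open Ultrafilter 𝒰

    -- If every value were missed on a large set, these finitely many sets would meet at some `i`,
    -- where `f i` would differ from every element of the chain, itself included.
    limit : (f : I → A) → ∃ λ a → Large (λ i → a ≡ f i)
    limit f = by-contradiction λ none →
      let i , misses = inhabited (meet-finite (avoided none))
      in misses (F.from (f i)) (F.strictlyInverseˡ (f i))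
      where
      module F = Inverse (proj₂ finite)

      avoided : ¬ (∃ λ a → Large (λ i → a ≡ f i)) → ∀ k → Large (λ i → F.to k ≢ f i)
      avoided none k with dichotomy (λ i → F.to k ≡ f i)
      ... | inj₁ hit  = contradiction (F.to k , hit) none
      ... | inj₂ miss = miss

    _∼_ : Rel (∀ i → Dom (N i)) 0ℓ
    f ∼ g = Large (λ i → f i ≡ g i)

    ∼-isEquivalence : IsEquivalence _∼_
    ∼-isEquivalence = record
      { refl  = everywhere λ _ → refl
      ; sym   = upward sym
      ; trans = meet-with λ (p , q) → trans p q
      }

  module Łoś {I : Set ℓ} (𝒰 : Ultrafilter I) (N : I → Structure) (𝒬 : Quotient (_∼_ 𝒰 N)) where
    open Ultrafilter 𝒰
    open Quotient 𝒬
    private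
      module N i = Structure (N i)

    at : ∀ i → Class → Dom (N i)
    at i x = rep x i

    at-class : ∀ f → Large (λ i → at i (class f) ≡ f i)
    at-class f = upward sym (class-rep f)

    ultraproduct : Structure
    ultraproduct = record
      { Dom      = Class
      ; nonempty = class N.nonempty
      ; func     = λ F xs → class λ i → N.func i F (map (at i) xs)
      ; pred     = λ P xs → proj₁ (limit 𝒰 N λ i → N.pred i P (map (at i) xs))
      }

    mutual
      łoś-term : ∀ {n} (t : Term n) v →
        Large (λ i → at i (⟦_⟧ᵗ ultraproduct t v) ≡ ⟦_⟧ᵗ (N i) t (map (at i) v))
      łoś-term (var j)    v = everywhere λ i → sym (lookup-map j (at i) v)
      łoś-term (fun F ts) v = meet-with (λ {i} (p , q) → trans p (cong (N.func i F) q))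
        (at-class _) (łoś-terms ts v)

      łoś-terms : ∀ {n k} (ts : Vec (Term n) k) v →
        Large (λ i → map (at i) (⟦_⟧ᵗˢ ultraproduct ts v) ≡ ⟦_⟧ᵗˢ (N i) ts (map (at i) v))
      łoś-terms []       v = everywhere λ _ → refl
      łoś-terms (t ∷ ts) v = meet-with (λ (p , q) → cong₂ _∷_ p q) (łoś-term t v) (łoś-terms ts v)

    module _ {n} (φ : Formula (suc n)) (v : Vec Class n)
             (ih : ∀ x → Large (λ i → ⟦_⟧ ultraproduct φ (x ∷ v) ≡ ⟦_⟧ (N i) φ (at i x ∷ map (at i) v))) where

      -- The extremal value is attained in the ultraproduct and, coordinatewise, in
      -- the factors; each witness bounds one extremum by the other.
      łoś-quantifier : (R : Rel A ℓ) → (∀ {a b} → R a b → R b a → a ≡ b) →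
        (Q : ∀ {D : Set ℓ} → (D → A) → A) →
        (∀ {D} (f : D → A) d → R (Q f) (f d)) →
        (∀ {D} (f : D → A) → D → ∃ λ d → f d ≡ Q f) →
        Large (λ i → Q (λ x → ⟦_⟧ ultraproduct φ (x ∷ v)) ≡ Q (λ d → ⟦_⟧ (N i) φ (d ∷ map (at i) v)))
      łoś-quantifier R R-antisym Q bound attained =
        meet-with (λ (p , q) → R-antisym q p) above below
        where
        value : Class → A
        value x = ⟦_⟧ ultraproduct φ (x ∷ v)

        valueAt : ∀ i → Dom (N i) → A
        valueAt i d = ⟦_⟧ (N i) φ (d ∷ map (at i) v)

        above : Large (λ i → R (Q (valueAt i)) (Q value))
        above with attained value (class N.nonempty)
        ... | x , value-x = upward
          (λ {i} eq → subst (R _) (trans (sym eq) value-x) (bound (valueAt i) (at i x))) (ih x)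

        below : Large (λ i → R (Q value) (Q (valueAt i)))
        below = meet-with
          (λ {i} (at-x , eq) → subst (R _)
            (trans eq (trans (cong (valueAt i) at-x) (proj₂ (attained (valueAt i) (N.nonempty i)))))
            (bound value x))
          (at-class witnesses) (ih x)
          where
          witnesses : ∀ i → Dom (N i)
          witnesses i = proj₁ (attained (valueAt i) (N.nonempty i))

          x : Class
          x = class witnesses

    mutual
      łoś : ∀ {n} (φ : Formula n) v →
        Large (λ i → ⟦_⟧ ultraproduct φ v ≡ ⟦_⟧ (N i) φ (map (at i) v))
      łoś (pr P ts) v = meet-with (λ {i} (p , q) → trans p (cong (N.pred i P) q))
        (proj₂ (limit 𝒰 N λ i → N.pred i P (map (at i) (⟦_⟧ᵗˢ ultraproduct ts v)))) (łoś-terms ts v)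
      -- Equality of classes is compared with equality in the factors through the representatives:
      -- if these agree on a large set, `rep-separated` identifies the classes; if they differ on
      -- one, the classes are distinct.
      łoś (s ≈̇ t)   v = agree (dichotomy λ i → at i s* ≡ at i t*)
        where
        s* = ⟦_⟧ᵗ ultraproduct s v
        t* = ⟦_⟧ᵗ ultraproduct t v

        Agree : Pred I ℓ
        Agree i = crisp (em {P = s* ≡ t*}) ≡
          crisp (em {P = ⟦_⟧ᵗ (N i) s (map (at i) v) ≡ ⟦_⟧ᵗ (N i) t (map (at i) v)})

        agree : Large (λ i → at i s* ≡ at i t*) ⊎ Large (λ i → at i s* ≢ at i t*) → Large Agree
        agree (inj₁ same) = meet-with
          (λ (e , p , q) → crisp-cong em em (λ _ → trans (sym p) (trans e q)) (λ _ → rep-separated same))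
          same (meet (łoś-term s v) (łoś-term t v))
        agree (inj₂ differ) = meet-with
          (λ {i} (e , p , q) → crisp-cong em em
            (λ s*≡t* → contradiction (cong (at i) s*≡t*) e)
            (λ s≡t → contradiction (trans p (trans s≡t (sym q))) e))
          differ (meet (łoś-term s v) (łoś-term t v))
      łoś (const a) v = everywhere λ _ → refl
      łoś (φ ∧̇ ψ)   v = meet-with (λ (p , q) → cong₂ _∧_ p q) (łoś φ v) (łoś ψ v)
      łoś (φ ∨̇ ψ)   v = meet-with (λ (p , q) → cong₂ _∨_ p q) (łoś φ v) (łoś ψ v)
      łoś (φ &̇ ψ)   v = meet-with (λ (p , q) → cong₂ _&_ p q) (łoś φ v) (łoś ψ v)
      łoś (φ ⇒̇ ψ)   v = meet-with (λ (p , q) → cong₂ _⇒_ p q) (łoś φ v) (łoś ψ v)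
      łoś (op o φs) v = upward (cong (interp o)) (łoś-vec φs v)
      łoś (∀̇ φ)     v = łoś-quantifier φ v (λ x → łoś φ (x ∷ v)) _≤_ ≤-antisym ⋀ ⋀-lower ⋀-attained
      łoś (∃̇ φ)     v = łoś-quantifier φ v (λ x → łoś φ (x ∷ v)) (flip _≤_) (flip ≤-antisym) ⋁ ⋁-upper ⋁-attained

      łoś-vec : ∀ {n k} (φs : Vec (Formula n) k) v →
        Large (λ i → ⟦_⟧ˢ ultraproduct φs v ≡ ⟦_⟧ˢ (N i) φs (map (at i) v))
      łoś-vec []       v = everywhere λ _ → refl
      łoś-vec (φ ∷ φs) v = meet-with (λ (p , q) → cong₂ _∷_ p q) (łoś φ v) (łoś-vec φs v)

-- Universal closure over a block of variables.

module UniversalClosure {ℓ} (em : ExcludedMiddle ℓ) (𝐀 : FiniteMTLChain ℓ) (𝒫 : Language ℓ) where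
  open FiniteMTLChain 𝐀 using (1#)
  open Semantics em 𝐀 𝒫
  open Chain em 𝐀

  -- The bound block precedes the free variables, so `suc k + n` reduces and a quantifier can be
  -- peeled off without transport.
  ∀* : ∀ k {n} → Formula (k + n) → Formula n
  ∀* zero    φ = φ
  ∀* (suc k) φ = ∀* k (∀̇ φ)

  ∀*-universal : ∀ k {n} {φ : Formula (k + n)} → Universal φ → Universal (∀* k φ)
  ∀*-universal zero    u = u
  ∀*-universal (suc k) u = ∀*-universal k (∀̇ u)

  ∀*-intro : ∀ {M} k {n} (φ : Formula (k + n)) d →
    (∀ v → ⟦_⟧ M φ (v Vec.++ d) ≡ 1#) → ⟦_⟧ M (∀* k φ) d ≡ 1#
  ∀*-intro zero    φ d valid = valid []
  ∀*-intro (suc k) φ d valid = ∀*-intro k (∀̇ φ) d λ v →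
    1≤⇒≡1 (⋀-greatest _ λ x → ≤-reflexive (sym (valid (x ∷ v))))

  ∀*-elim : ∀ {M} k {n} (φ : Formula (k + n)) d →
    ⟦_⟧ M (∀* k φ) d ≡ 1# → ∀ v → ⟦_⟧ M φ (v Vec.++ d) ≡ 1#
  ∀*-elim zero    φ d valid []      = valid
  ∀*-elim (suc k) φ d valid (x ∷ v) =
    1≤⇒≡1 (≤-trans (≤-reflexive (sym (∀*-elim k (∀̇ φ) d valid v))) (⋀-lower _ x))

-- Finite parts of the diagram and their formulas.

module Diagrams {ℓ} (em : ExcludedMiddle ℓ) (𝐀 : FiniteMTLChain ℓ) (𝒫 : Language ℓ)
                (0≢1 : FiniteMTLChain.0# 𝐀 ≢ FiniteMTLChain.1# 𝐀) where
  open FiniteMTLChain 𝐀 using (0#; 1#; _≤_)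
  open Language 𝒫
  open Semantics em 𝐀 𝒫
  open Chain em 𝐀

  crisp≡1⇒ : ∀ {P : Set ℓ} (P? : Dec P) → crisp P? ≡ 1# → P
  crisp≡1⇒ (yes p) _   = p
  crisp≡1⇒ (no _)  0≡1 = contradiction 0≡1 0≢1

  ⇒crisp≡1 : ∀ {P : Set ℓ} (P? : Dec P) → P → crisp P? ≡ 1#
  ⇒crisp≡1 (yes _) _ = refl
  ⇒crisp≡1 (no ¬p) p = contradiction p ¬p

  crisp≤0⇒ : ∀ {P : Set ℓ} (P? : Dec P) → crisp P? ≤ 0# → ¬ P
  crisp≤0⇒ (yes _) 1≤0 _ = 0≢1 (1≤⇒≡1 1≤0)
  crisp≤0⇒ (no ¬p) _     = ¬p

  ⇒crisp≤0 : ∀ {P : Set ℓ} (P? : Dec P) → ¬ P → crisp P? ≤ 0#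
  ⇒crisp≤0 (yes p) ¬p = contradiction p ¬p
  ⇒crisp≤0 (no _)  _  = ≤-refl

  map-≗-on : ∀ {a b} {X : Set a} {Y : Set b} {f g : X → Y} {k} (xs : Vec X k) →
    (∀ {x} → x ∈ Vec.toList xs → f x ≡ g x) → map f xs ≡ map g xs
  map-≗-on []       f≗g = refl
  map-≗-on (x ∷ xs) f≗g = cong₂ _∷_ (f≗g (here refl)) (map-≗-on xs (f≗g ∘ there))

  lookup-injective : ∀ {a} {X : Set a} {k} {xs ys : Vec X k} → (∀ j → lookup xs j ≡ lookup ys j) → xs ≡ ys
  lookup-injective {xs = xs} {ys} eq =
    trans (sym (tabulate∘lookup xs)) (trans (tabulate-cong eq) (tabulate∘lookup ys))

  module _ (M : Structure) {n} (d : Vec (Dom M) n) where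
    private
      module M = Structure M

    -- The diagram is kept semantic: a fact mentions elements of `M`, and becomes a formula only
    -- after finitely many variables have been allotted. Facts of equality are absent because an
    -- assignment, being a function, respects them anyway.
    data Fact : Set ℓ where
      value    : ∀ {k} (P : Pr k) (xs : Vec (Dom M) k) → Fact
      graph    : ∀ {k} (F : Func k) (xs : Vec (Dom M) k) → Fact
      distinct : ∀ {x y : Dom M} → x ≢ y → Fact
      param    : (j : Fin n) → Fact

    Holds : (N : Structure) → (Dom M → Dom N) → Vec (Dom N) n → Pred Fact ℓ
    Holds N e b (value P xs)         = Structure.pred N P (map e xs) ≡ M.pred P xs
    Holds N e b (graph F xs)         = e (M.func F xs) ≡ Structure.func N F (map e xs)
    Holds N e b (distinct {x} {y} _) = e x ≢ e y
    Holds N e b (param j)            = e (lookup d j) ≡ lookup b j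

    support : Fact → List (Dom M)
    support (value P xs)         = Vec.toList xs
    support (graph F xs)         = M.func F xs ∷ Vec.toList xs
    support (distinct {x} {y} _) = x ∷ y ∷ []
    support (param j)            = lookup d j ∷ []

    -- An assignment read off from finitely many variables cannot in general be the identity on `M`,
    -- so it is required to fix only the support.
    holds-in-M : ∀ δ {e} → (∀ {x} → x ∈ support δ → e x ≡ x) → Holds M e d δ
    holds-in-M (value P xs) fixed = cong (M.pred P) (trans (map-≗-on xs fixed) (map-id xs))
    holds-in-M (graph F xs) fixed = trans (fixed (here refl))
      (cong (M.func F) (sym (trans (map-≗-on xs (fixed ∘ there)) (map-id xs))))
    holds-in-M (distinct x≢y) fixed ex≡ey =
      x≢y (trans (sym (fixed (here refl))) (trans ex≡ey (fixed (there (here refl)))))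
    holds-in-M (param j) fixed = fixed (here refl)

    module _ {k} (name : Dom M → Fin k) where

      term : Dom M → Term (k + n)
      term x = var (name x ↑ˡ n)

      -- An implication is `1#` exactly when its left side is at most its right side. Hence the two
      -- implications pin `P` to the value `a`, and `⇒̇ const 0#` negates crisp equality.
      formula : Fact → Formula (k + n)
      formula (value P xs)         = (pr P (map term xs) ⇒̇ const a) ∧̇ (const a ⇒̇ pr P (map term xs))
        where a = M.pred P xs
      formula (graph F xs)         = term (M.func F xs) ≈̇ fun F (map term xs)
      formula (distinct {x} {y} _) = (term x ≈̇ term y) ⇒̇ const 0#
      formula (param j)            = term (lookup d j) ≈̇ var (k ↑ʳ j)

      formula-quantifierFree : ∀ δ → QuantifierFree (formula δ)
      formula-quantifierFree (value P xs) = (pr P _ ⇒̇ const _) ∧̇ (const _ ⇒̇ pr P _)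
      formula-quantifierFree (graph F xs) = _ ≈̇ _
      formula-quantifierFree (distinct _) = (_ ≈̇ _) ⇒̇ const 0#
      formula-quantifierFree (param j)    = _ ≈̇ _

      conjunction : List Fact → Formula (k + n)
      conjunction []      = const 1#
      conjunction (δ ∷ Δ) = formula δ ∧̇ conjunction Δ

      conjunction-quantifierFree : ∀ Δ → QuantifierFree (conjunction Δ)
      conjunction-quantifierFree []      = const 1#
      conjunction-quantifierFree (δ ∷ Δ) = formula-quantifierFree δ ∧̇ conjunction-quantifierFree Δ

      module _ (N : Structure) (v : Vec (Dom N) k) (b : Vec (Dom N) n) where
        private
          w : Vec (Dom N) (k + n)
          w = v Vec.++ b

          e : Dom M → Dom N
          e = lookup v ∘ name

        term-value : ∀ x → ⟦_⟧ᵗ N (term x) w ≡ e x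
        term-value x = lookup-++ˡ v b (name x)

        terms-value : ∀ {m} (xs : Vec (Dom M) m) → ⟦_⟧ᵗˢ N (map term xs) w ≡ map e xs
        terms-value []       = refl
        terms-value (x ∷ xs) = cong₂ _∷_ (term-value x) (terms-value xs)

        formula-sound : ∀ δ → ⟦_⟧ N (formula δ) w ≡ 1# → Holds N e b δ
        formula-sound (value P xs) eq with ∧≡1⇒ eq
        ... | le , ge = trans (cong (Structure.pred N P) (sym (terms-value xs)))
                              (≤-antisym (⇒≡1⇒≤ le) (⇒≡1⇒≤ ge))
        formula-sound (graph F xs) eq = trans (sym (term-value (M.func F xs)))
          (trans (crisp≡1⇒ em eq) (cong (Structure.func N F) (terms-value xs)))
        formula-sound (distinct {x} {y} _) eq ex≡ey =
          crisp≤0⇒ em (⇒≡1⇒≤ eq) (trans (term-value x) (trans ex≡ey (sym (term-value y))))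
        formula-sound (param j) eq = trans (sym (term-value (lookup d j)))
          (trans (crisp≡1⇒ em eq) (lookup-++ʳ v b j))

        formula-complete : ∀ δ → Holds N e b δ → ⟦_⟧ N (formula δ) w ≡ 1#
        formula-complete (value P xs) holds =
          ⇒∧≡1 (≤⇒⇒≡1 (≤-reflexive eq)) (≤⇒⇒≡1 (≤-reflexive (sym eq)))
          where
          eq : Structure.pred N P (⟦_⟧ᵗˢ N (map term xs) w) ≡ M.pred P xs
          eq = trans (cong (Structure.pred N P) (terms-value xs)) holds
        formula-complete (graph F xs) holds = ⇒crisp≡1 em
          (trans (term-value (M.func F xs)) (trans holds (cong (Structure.func N F) (sym (terms-value xs)))))
        formula-complete (distinct {x} {y} _) holds = ≤⇒⇒≡1 (⇒crisp≤0 em λ eq →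
          holds (trans (sym (term-value x)) (trans eq (term-value y))))
        formula-complete (param j) holds = ⇒crisp≡1 em
          (trans (term-value (lookup d j)) (trans holds (sym (lookup-++ʳ v b j))))

        conjunction-sound : ∀ Δ → ⟦_⟧ N (conjunction Δ) w ≡ 1# → All (Holds N e b) Δ
        conjunction-sound []      _  = []
        conjunction-sound (δ ∷ Δ) eq with ∧≡1⇒ eq
        ... | p , q = formula-sound δ p ∷ conjunction-sound Δ q

        conjunction-complete : ∀ {Δ} → All (Holds N e b) Δ → ⟦_⟧ N (conjunction Δ) w ≡ 1#
        conjunction-complete []       = refl
        conjunction-complete (p ∷ ps) = ⇒∧≡1 (formula-complete _ p) (conjunction-complete ps)

    -- The leading element makes `name` total: it serves every x outside the
    -- support of Δ, where the choice of variable is immaterial.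
    parameters : List Fact → List (Dom M)
    parameters Δ = M.nonempty ∷ List.concatMap support Δ

    name : ∀ Δ → Dom M → Fin (List.length (parameters Δ))
    name Δ x with em {P = x ∈ parameters Δ}
    ... | yes x∈ = index x∈
    ... | no _   = zero

    lookup-name : ∀ Δ {x} → x ∈ parameters Δ → lookup (Vec.fromList (parameters Δ)) (name Δ x) ≡ x
    lookup-name Δ {x} x∈ with em {P = x ∈ parameters Δ}
    ... | no x∉  = contradiction x∈ x∉
    ... | yes p  = at-index p
      where
      at-index : ∀ {xs} (p : x ∈ xs) → lookup (Vec.fromList xs) (index p) ≡ x
      at-index (here refl) = refl
      at-index (there p)   = at-index p

    holds-all-in-M : ∀ Δ → All (Holds M (lookup (Vec.fromList (parameters Δ)) ∘ name Δ) d) Δ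
    holds-all-in-M Δ = All.tabulate λ {δ} δ∈ → holds-in-M δ λ x∈ →
      lookup-name Δ (there (∈-concatMap⁺ support (lose δ∈ x∈)))

-- From preservation to a universal axiomatisation.

module Preservation (em : ∀ {a} → ExcludedMiddle a) (zorn : ∀ {c ℓ₁ ℓ₂ p} → Zorn c ℓ₁ ℓ₂ p)
                    {ℓ} (𝐀 : FiniteMTLChain ℓ) (𝒫 : Language ℓ) where
  open Choice em zorn
  open FiniteMTLChain 𝐀 using (0#; 1#; _≤_)
  open Semantics em 𝐀 𝒫
  open Chain em 𝐀
  open UniversalClosure em 𝐀 𝒫
  open Embeddings em 𝐀 𝒫
  open Images em zorn 𝐀 𝒫
  open Ultraproducts em zorn 𝐀 𝒫

  -- Quantifying over all structures lies in the universe above `ℓ`, whereas a set of formulas must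
  -- be a predicate at level `ℓ`.
  UniversalConsequence : Theory → ∀ {n} → Pred (Formula n) ℓ → Pred (Formula n) ℓ
  UniversalConsequence T Φ θ = Resize ℓ
    (Universal θ × (∀ M → M ⊨ᵀ T → ∀ d → M ⊨ Φ [ d ] → ⟦_⟧ M θ d ≡ 1#))

  module _ (0≢1 : 0# ≢ 1#) (T : Theory) {n} (Φ : Pred (Formula n) ℓ) (M : Structure) (d : Vec (Dom M) n) where
    open Diagrams em 𝐀 𝒫 0≢1

    record Realisation (Δ : List (Fact M d)) : Set (lsuc ℓ) where
      field
        model      : Structure
        satisfiesT : model ⊨ᵀ T
        tuple      : Vec (Dom model) n
        satisfiesΦ : model ⊨ Φ [ tuple ]
        assign     : Dom M → Dom model
        holds      : All (Holds M d model assign tuple) Δ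

    realise : M ⊨ UniversalConsequence T Φ [ d ] → ∀ Δ → Realisation Δ
    -- Excluded middle applied to the record itself returns an actual model, hence a whole family of
    -- factors indexed by the lists `Δ`.
    realise M⊨Θ Δ = by-contradiction impossible
      where
      k = proj₁ (coatom 0≢1)

      K = List.length (parameters M d Δ)

      χ : Formula (K + n)
      χ = conjunction M d (name M d Δ) Δ

      θ : Formula n
      θ = ∀* K (χ ⇒̇ const k)

      impossible : ¬ ¬ Realisation Δ
      -- Evaluating the closure in `M` with each variable standing for the parameter it names gives
      -- `1# ≤ k`, since `χ` is `1#` there.
      impossible unrealisable = proj₁ (proj₂ (coatom 0≢1)) (1≤⇒≡1 (subst (_≤ k) χ≡1
        (⇒≡1⇒≤ (∀*-elim K (χ ⇒̇ const k) d (M⊨Θ (resize (universal , consequence))) env))))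
        where
        env = Vec.fromList (parameters M d Δ)

        χ≡1 : ⟦_⟧ M χ (env Vec.++ d) ≡ 1#
        χ≡1 = conjunction-complete M d (name M d Δ) M env d (holds-all-in-M M d Δ)

        universal : Universal θ
        universal = ∀*-universal K (matrix (conjunction-quantifierFree M d (name M d Δ) Δ ⇒̇ const k))

        consequence : ∀ N → N ⊨ᵀ T → ∀ b → N ⊨ Φ [ b ] → ⟦_⟧ N θ b ≡ 1#
        consequence N N⊨T b N⊨Φ = ∀*-intro K (χ ⇒̇ const k) b λ v →
          ≤⇒⇒≡1 (proj₂ (proj₂ (coatom 0≢1)) λ χN≡1 → unrealisable record
            { model = N ; satisfiesT = N⊨T ; tuple = b ; satisfiesΦ = N⊨Φ
            ; assign = lookup v ∘ name M d Δ
            ; holds  = conjunction-sound M d (name M d Δ) N v b Δ χN≡1 })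

    module Limit (realised : ∀ Δ → Realisation Δ) (𝒰 : Ultrafilter (List (Fact M d)))
                 (cone : ∀ δ {P} → (∀ {Δ} → δ ∈ Δ → P Δ) → Ultrafilter.Large 𝒰 P)
                 (𝒬 : Quotient (_∼_ 𝒰 (Realisation.model ∘ realised))) where
      open Ultrafilter 𝒰
      private
        module R Δ = Realisation (realised Δ)
      open Quotient 𝒬
      open Łoś 𝒰 R.model 𝒬

      -- The factor at `Δ` realises every fact listed in `Δ`, and almost every `Δ` lists `δ`.
      eventually-holds : ∀ δ → Large (λ Δ → Holds M d (R.model Δ) (R.assign Δ) (R.tuple Δ) δ)
      eventually-holds δ = cone δ λ {Δ} δ∈Δ → All.lookup (R.holds Δ) δ∈Δ

      h : Dom M → Class
      h x = class λ Δ → R.assign Δ x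

      at-h : ∀ x → Large (λ Δ → at Δ (h x) ≡ R.assign Δ x)
      at-h x = at-class λ Δ → R.assign Δ x

      at-map-h : ∀ {k} (xs : Vec (Dom M) k) →
        Large (λ Δ → map (at Δ) (map h xs) ≡ map (R.assign Δ) xs)
      at-map-h []       = everywhere λ _ → refl
      at-map-h (x ∷ xs) = meet-with (λ (p , q) → cong₂ _∷_ p q) (at-h x) (at-map-h xs)

      embedding : Embedding M ultraproduct
      embedding = record
        { to        = h
        ; injective = λ {x} {y} hx≡hy → by-contradiction λ x≢y →
            let Δ , (ex , ey) , ex≢ey =
                  inhabited (meet (meet (at-h x) (at-h y)) (eventually-holds (distinct x≢y)))
            in ex≢ey (trans (sym ex) (trans (cong (at Δ) hx≡hy) ey))
        ; func-homo = λ F xs → rep-separated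
            (meet-with
              (λ {Δ} ((p , q) , (r , s)) → trans p (trans s
                (trans (cong (Structure.func (R.model Δ) F) (sym q)) (sym r))))
              (meet (at-h _) (at-map-h xs))
              (meet (at-class _) (eventually-holds (graph F xs))))
        -- Both sides are truth values that do not depend on `Δ`, so a single index meeting all
        -- three conditions decides; equality of classes, as for functions, needs a large set.
        ; pred-homo = λ P xs →
            let Δ , (p , q) , r = inhabited
                  (meet (meet (at-map-h xs) (eventually-holds (value P xs)))
                        (proj₂ (limit 𝒰 R.model λ Δ → Structure.pred (R.model Δ) P (map (at Δ) (map h xs)))))
            in sym (trans r (trans (cong (Structure.pred (R.model Δ) P) p) q))
        }

      ultraproduct⊨T : ultraproduct ⊨ᵀ T
      ultraproduct⊨T {φ} φ∈T = let Δ , eq = inhabited (łoś φ []) in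
        trans eq (R.satisfiesT Δ φ∈T)

      -- The tuple satisfying `Φ` in a factor is tied to the assigned copy of `d` only by the
      -- `param` facts; there are `n` of them, so almost every factor has them all.
      at-map-h-d : Large (λ Δ → map (at Δ) (map h d) ≡ R.tuple Δ)
      at-map-h-d = meet-with (λ (p , params) → trans p (lookup-injective λ j →
          trans (lookup-map j _ d) (params j)))
        (at-map-h d) (meet-finite λ j → eventually-holds (param j))

      ultraproduct⊨Φ : ultraproduct ⊨ Φ [ map h d ]
      ultraproduct⊨Φ {φ} φ∈Φ =
        let Δ , eq , p = inhabited (meet (łoś φ (map h d)) at-map-h-d) in
        trans eq (trans (cong (⟦_⟧ (R.model Δ) φ) p) (R.satisfiesΦ Δ φ∈Φ))

      extension : ∃ λ N → N ⊨ᵀ T × Σ (Embedding M N) λ f → N ⊨ Φ [ map (Embedding.to f) d ]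
      extension = ultraproduct , ultraproduct⊨T , embedding , ultraproduct⊨Φ

    extension : M ⊨ UniversalConsequence T Φ [ d ] →
      ∃ λ N → N ⊨ᵀ T × Σ (Embedding M N) λ f → N ⊨ Φ [ map (Embedding.to f) d ]
    extension M⊨Θ = let 𝒰 , cone = cone-ultrafilter (Fact M d) in
      Limit.extension (realise M⊨Θ) 𝒰 cone
        (quotient (∼-isEquivalence 𝒰 (Realisation.model ∘ realise M⊨Θ)))

  -- Preservation speaks of literal substructures, so `M` is replaced by its image, which is
  -- isomorphic to it and hence gives every formula the same value.
  preserved-along-embeddings : ∀ {T n} {Φ : Pred (Formula n) ℓ} → PreservedUnderSubstructures T Φ →
    ∀ {M N} (f : Embedding M N) → M ⊨ᵀ T → N ⊨ᵀ T →
    ∀ d → N ⊨ Φ [ map (Embedding.to f) d ] → M ⊨ Φ [ d ]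
  preserved-along-embeddings {T} preserved {M} {N} f M⊨T N⊨T d N⊨Φ {φ} φ∈Φ =
    trans (absolute φ d) (preserved N (image f) image⊨T N⊨T (map to d)
      (λ {ψ} ψ∈Φ → subst (λ e → ⟦_⟧ N ψ e ≡ 1#) (map-∘ proj₁ to d) (N⊨Φ ψ∈Φ)) φ∈Φ)
    where
    open Embedding (onto-image f) using (to)

    absolute : ∀ {k} (ψ : Formula k) v → ⟦_⟧ M ψ v ≡ ⟦_⟧ (induced (image f)) ψ (map to v)
    absolute = Embedding.absolute (onto-image f) (onto-image-surjective f)

    image⊨T : induced (image f) ⊨ᵀ T
    image⊨T {ψ} ψ∈T = trans (sym (absolute ψ [])) (M⊨T ψ∈T)

  preserved⇒universallyAxiomatised : ∀ {T n} {Φ : Pred (Formula n) ℓ} →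
    PreservedUnderSubstructures T Φ → UniversallyAxiomatised T Φ
  preserved⇒universallyAxiomatised {T} {n} {Φ} preserved =
    Θ , (λ θ∈ → proj₁ (unresize θ∈)) , (λ M M⊨T d M⊨Φ θ∈ → proj₂ (unresize θ∈) M M⊨T d M⊨Φ) ,
    λ M M⊨T d M⊨Θ → axiomatises M M⊨T d M⊨Θ em
    where
    Θ = UniversalConsequence T Φ

    axiomatises : ∀ M → M ⊨ᵀ T → ∀ d → M ⊨ Θ [ d ] → Dec (0# ≡ 1#) → M ⊨ Φ [ d ]
    -- The trivial algebra has no value below `1#` to serve as `k`, but there every formula takes
    -- the value `1#`.
    axiomatises M M⊨T d M⊨Θ (yes 0≡1) {φ} φ∈Φ = 1≤⇒≡1 (subst (_≤ ⟦_⟧ M φ d) 0≡1 (minimum _))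
    axiomatises M M⊨T d M⊨Θ (no 0≢1) =
      let N , N⊨T , f , N⊨Φ = extension 0≢1 T Φ M d M⊨Θ in
      preserved-along-embeddings preserved f M⊨T N⊨T d N⊨Φ

mainTheorem3 : (em : ∀ {a} → ExcludedMiddle a) →
    (zorn : ∀ {c ℓ₁ ℓ₂ p} → Zorn c ℓ₁ ℓ₂ p) →
    ∀ {ℓ} (𝐀 : FiniteMTLChain ℓ) (𝒫 : Language ℓ) →
    let open Semantics em 𝐀 𝒫 in
    (T : Theory) (n : ℕ) (Φ : Pred (Formula n) ℓ) →
    PreservedUnderSubstructures T Φ ⇔ UniversallyAxiomatised T Φ
mainTheorem3 em zorn 𝐀 𝒫 T n Φ = mk⇔
  (Preservation.preserved⇒universallyAxiomatised em zorn 𝐀 𝒫)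
  (Embeddings.universallyAxiomatised⇒preserved em 𝐀 𝒫)
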